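{- The rule (UC): from $(p\rightsquigarrow\phi)\wedge\Box p\to\psi$ infer $\Box\phi\to\psi$ (where $p$ is a propositional variable not occurring in $\phi,\psi$) is admissible in $\mathsf{MS^2IC}$: whenever $(p\rightsquigarrow\phi)\wedge\Box p\to\psi$ is a theorem of $\mathsf{MS^2IC}$ with $p$ not occurring in $\phi,\psi$, so is $\Box\phi\to\psi$.
   Context: Language: propositional variables, $\top,\bot$, $\neg,\wedge,\vee,\to,\leftrightarrow$, a binary connective $\rightsquigarrow$ and a unary modality $\Box$; $\Diamond\phi:=\neg\Box\neg\phi$, $[\forall]\phi:=\top\rightsquigarrow\phi$. $\mathsf{MS^2IC}$: theorems are the least set containing all instances of classical tautologies and of (A1) $(\bot\rightsquigarrow\phi)\wedge(\phi\rightsquigarrow\top)$; (A2) $((\phi\vee\psi)\rightsquigarrow\chi)\leftrightarrow((\phi\rightsquigarrow\chi)\wedge(\psi\rightsquigarrow\chi))$; (A3) $(\phi\rightsquigarrow(\psi\wedge\chi))\leftrightarrow((\phi\rightsquigarrow\psi)\wedge(\phi\rightsquigarrow\chi))$; (A4) $(\phi\rightsquigarrow\psi)\to(\phi\to\psi)$; (A5) $(\phi\rightsquigarrow\psi)\leftrightarrow(\neg\psi\rightsquigarrow\neg\phi)$; (A8) $[\forall]\phi\to[\forall][\forall]\phi$; (A9) $\neg[\forall]\phi\to[\forall]\neg[\forall]\phi$; (A10) $(\phi\rightsquigarrow\psi)\leftrightarrow[\forall](\phi\rightsquigarrow\psi)$; (A11) $[\forall]\phi\to(\neg[\forall]\phi\rightsquigarrow\bot)$;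 (K) $\Box(\phi\to\psi)\to(\Box\phi\to\Box\psi)$; (Add) $(\phi\rightsquigarrow\psi)\to(\Box\phi\rightsquigarrow\Box\psi)$; closed under modus ponens, from $\phi$ infer $[\forall]\phi$, from $\phi$ infer $\Box\phi$. -}

module Defs where

open import Data.Nat using (ℕ)
open import Relation.Binary.PropositionalEquality using (_≡_)
open import Relation.Nullary using (¬_)
open import Data.Sum using (_⊎_)
open import Data.Bool using (Bool; true; false)

infixr 4 _⇒_ _⇔_
infixr 5 _∨_
infixr 6 _∧_
infix 7 _⇝_

data Form : Set where
  var  : ℕ → Form
  ⊤'   : Form
  ⊥'   : Form
  ¬'   : Form → Form
  _∧_  : Form → Form → Form
  _∨_  : Form → Form → Form
  _⇒_  : Form → Form → Form
  _⇔_  : Form → Form → Form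
  _⇝_  : Form → Form → Form
  □    : Form → Form

◇ : Form → Form
◇ φ = ¬' (□ (¬' φ))

A∀ : Form → Form
A∀ φ = ⊤' ⇝ φ

-- Classical two-valued semantics treating ⇝- and □-formulas as atoms;
-- a "classical tautology instance" is a formula true under every such valuation.
-- A valuation assigns truth values to all formulas that are atoms for
-- propositional logic (variables, ⇝-formulas, □-formulas).
evalPL : (Form → Bool) → Form → Bool
evalPL v (var n) = v (var n)
evalPL v ⊤' = true
evalPL v ⊥' = false
evalPL v (¬' φ) with evalPL v φ
... | true = false
... | false = true
evalPL v (φ ∧ ψ) with evalPL v φ
... | true = evalPL v ψ
... | false = false
evalPL v (φ ∨ ψ) with evalPL v φ
... | true = true
... | false = evalPL v ψ
evalPL v (φ ⇒ ψ) with evalPL v φ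
... | true = evalPL v ψ
... | false = true
evalPL v (φ ⇔ ψ) with evalPL v φ | evalPL v ψ
... | true  | true  = true
... | true  | false = false
... | false | true  = false
... | false | false = true
evalPL v (φ ⇝ ψ) = v (φ ⇝ ψ)
evalPL v (□ φ) = v (□ φ)

Tautology : Form → Set
Tautology φ = (v : Form → Bool) → evalPL v φ ≡ true

data ⊢_ : Form → Set where
  taut : ∀ {φ} → Tautology φ → ⊢ φ
  A1   : ∀ {φ} → ⊢ ((⊥' ⇝ φ) ∧ (φ ⇝ ⊤'))
  A2   : ∀ {φ ψ χ} → ⊢ (((φ ∨ ψ) ⇝ χ) ⇔ ((φ ⇝ χ) ∧ (ψ ⇝ χ)))
  A3   : ∀ {φ ψ χ} → ⊢ ((φ ⇝ (ψ ∧ χ)) ⇔ ((φ ⇝ ψ) ∧ (φ ⇝ χ)))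
  A4   : ∀ {φ ψ} → ⊢ ((φ ⇝ ψ) ⇒ (φ ⇒ ψ))
  A5   : ∀ {φ ψ} → ⊢ ((φ ⇝ ψ) ⇔ (¬' ψ ⇝ ¬' φ))
  A8   : ∀ {φ} → ⊢ (A∀ φ ⇒ A∀ (A∀ φ))
  A9   : ∀ {φ} → ⊢ (¬' (A∀ φ) ⇒ A∀ (¬' (A∀ φ)))
  A10  : ∀ {φ ψ} → ⊢ ((φ ⇝ ψ) ⇔ A∀ (φ ⇝ ψ))
  A11  : ∀ {φ} → ⊢ (A∀ φ ⇒ (¬' (A∀ φ) ⇝ ⊥'))
  K    : ∀ {φ ψ} → ⊢ (□ (φ ⇒ ψ) ⇒ (□ φ ⇒ □ ψ))
  Add  : ∀ {φ ψ} → ⊢ ((φ ⇝ ψ) ⇒ (□ φ ⇝ □ ψ))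
  MP   : ∀ {φ ψ} → ⊢ (φ ⇒ ψ) → ⊢ φ → ⊢ ψ
  Nec∀ : ∀ {φ} → ⊢ φ → ⊢ A∀ φ
  Nec□ : ∀ {φ} → ⊢ φ → ⊢ □ φ

data _occursIn_ (p : ℕ) : Form → Set where
  here : p occursIn var p
  ¬o   : ∀ {φ} → p occursIn φ → p occursIn ¬' φ
  ∧l   : ∀ {φ ψ} → p occursIn φ → p occursIn (φ ∧ ψ)
  ∧r   : ∀ {φ ψ} → p occursIn ψ → p occursIn (φ ∧ ψ)
  ∨l   : ∀ {φ ψ} → p occursIn φ → p occursIn (φ ∨ ψ)
  ∨r   : ∀ {φ ψ} → p occursIn ψ → p occursIn (φ ∨ ψ)
  ⇒l   : ∀ {φ ψ} → p occursIn φ → p occursIn (φ ⇒ ψ)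
  ⇒r   : ∀ {φ ψ} → p occursIn ψ → p occursIn (φ ⇒ ψ)
  ⇔l   : ∀ {φ ψ} → p occursIn φ → p occursIn (φ ⇔ ψ)
  ⇔r   : ∀ {φ ψ} → p occursIn ψ → p occursIn (φ ⇔ ψ)
  ⇝l   : ∀ {φ ψ} → p occursIn φ → p occursIn (φ ⇝ ψ)
  ⇝r   : ∀ {φ ψ} → p occursIn ψ → p occursIn (φ ⇝ ψ)
  □o   : ∀ {φ} → p occursIn φ → p occursIn □ φ

{-# OPTIONS --safe #-}

-- The calculus does not make ⇝ a congruence, so instead of extending a model we
-- translate derivations.  The translation t sends p to φ, commutes with the
-- Boolean connectives and □, and fixes formulas without p.  On a formula a ⇝ b
-- containing p its value is the one forced by A1–A11 and Add, and A∀ (t a ⇒ t b)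
-- where they force nothing.  So p behaves as a copy of φ that is related to other
-- formulas by global implication only: p ⇝ φ translates to a theorem, being a
-- conjunction of formulas A∀ (φ ⇒ φᵢ), whereas φ ⇝ φ need not be one.

module Submission where

open import Defs
open import Data.Nat using (ℕ; _≟_)
open import Data.Bool using (Bool; true; false)
open import Data.Product using (_×_; _,_; proj₁; proj₂)
open import Data.Sum using (_⊎_; inj₁; inj₂; [_,_]′)
open import Function using (_∘_; id)
open import Relation.Nullary using (¬_; Dec; yes; no; contradiction)
open import Relation.Nullary.Decidable using (map′; _⊎-dec_)
open import Relation.Binary.PropositionalEquality
  using (_≡_; refl; sym; trans; cong; cong₂; subst; subst₂)

-- Truth under a fixed valuation

private variable
  a b c x y : Form
  v : Form → Bool

-- The record wrapper lets `v` and `a` be inferred by unification, which the equation on `evalPL`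
-- alone, being a computed value, would not allow.
record _⊨_ (v : Form → Bool) (a : Form) : Set where
  constructor holds
  field truth : evalPL v a ≡ true
open _⊨_

⇒-intro : (v ⊨ a → v ⊨ b) → v ⊨ (a ⇒ b)
⇒-intro {v} {a} f with evalPL v a in eq
... | true  = holds (lemma eq)
  where
  lemma : evalPL v a ≡ true → evalPL v (a ⇒ _) ≡ true
  lemma e rewrite e = truth (f (holds e))
... | false = holds (lemma eq)
  where
  lemma : evalPL v a ≡ false → evalPL v (a ⇒ _) ≡ true
  lemma e rewrite e = refl

⇒-elim : v ⊨ (a ⇒ b) → v ⊨ a → v ⊨ b
⇒-elim {v} {a} (holds h) (holds k) rewrite k = holds h

∧-intro : v ⊨ a → v ⊨ b → v ⊨ (a ∧ b)
∧-intro {v} {a} {b} (holds h) (holds k) = holds lemma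
  where
  lemma : evalPL v (a ∧ b) ≡ true
  lemma rewrite h = k

∧-elim : v ⊨ (a ∧ b) → v ⊨ a × v ⊨ b
∧-elim {v} {a} (holds h) with evalPL v a in eq
... | true = holds eq , holds h

∨-elim : v ⊨ (a ∨ b) → v ⊨ a ⊎ v ⊨ b
∨-elim {v} {a} (holds h) with evalPL v a in eq
... | true  = inj₁ (holds eq)
... | false = inj₂ (holds h)

⊨-em : ∀ v a → v ⊨ a ⊎ v ⊨ ¬' a
⊨-em v a with evalPL v a in eq
... | true  = inj₁ (holds eq)
... | false = inj₂ (holds lemma)
  where
  lemma : evalPL v (¬' a) ≡ true
  lemma rewrite eq = refl

¬-elim : v ⊨ ¬' a → v ⊨ a → v ⊨ b
¬-elim {v} {a} (holds h) (holds k) rewrite k with () ← h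

¬-intro : (v ⊨ a → v ⊨ ¬' a) → v ⊨ ¬' a
¬-intro f = [ f , id ]′ (⊨-em _ _)

⇔-intro : (v ⊨ a → v ⊨ b) → (v ⊨ b → v ⊨ a) → v ⊨ (a ⇔ b)
⇔-intro {v} {a} {b} f g with evalPL v a in eqa | evalPL v b in eqb
... | true  | true  = holds lemma
  where
  lemma : evalPL v (a ⇔ b) ≡ true
  lemma rewrite eqa | eqb = refl
... | false | false = holds lemma
  where
  lemma : evalPL v (a ⇔ b) ≡ true
  lemma rewrite eqa | eqb = refl
... | true  | false with () ← subst (_≡ true) eqb (truth (f (holds eqa)))
... | false | true  with () ← subst (_≡ true) eqa (truth (g (holds eqb)))

⇔-elim : v ⊨ (a ⇔ b) → (v ⊨ a → v ⊨ b) × (v ⊨ b → v ⊨ a)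
⇔-elim {v} {a} {b} (holds h) with evalPL v a in eqa | evalPL v b in eqb
... | true  | true  = (λ _ → holds eqb) , (λ _ → holds eqa)
... | false | false = (λ { (holds k) → contradiction k (false≢true eqa) })
                    , (λ { (holds k) → contradiction k (false≢true eqb) })
  where
  false≢true : ∀ {w : Bool} → w ≡ false → ¬ (w ≡ true)
  false≢true refl ()

-- Derived rules of the calculus

entail₀ : (∀ {v} → v ⊨ a) → ⊢ a
entail₀ f = taut λ _ → truth f

entail₁ : (∀ {v} → v ⊨ a → v ⊨ b) → ⊢ a → ⊢ b
entail₁ f = MP (entail₀ (⇒-intro f))

entail₂ : (∀ {v} → v ⊨ a → v ⊨ b → v ⊨ c) → ⊢ a → ⊢ b → ⊢ c
entail₂ f d = MP (entail₁ (λ h → ⇒-intro (f h)) d)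

⇒-refl : ⊢ (a ⇒ a)
⇒-refl = entail₀ (⇒-intro id)

infixr 5 _⟫_
_⟫_ : ⊢ (a ⇒ b) → ⊢ (b ⇒ c) → ⊢ (a ⇒ c)
_⟫_ = entail₂ λ f g → ⇒-intro (⇒-elim g ∘ ⇒-elim f)

⇔-refl : ⊢ (a ⇔ a)
⇔-refl = entail₀ (⇔-intro id id)

⇔-to : ⊢ (a ⇔ b) → ⊢ (a ⇒ b)
⇔-to = entail₁ λ h → ⇒-intro (proj₁ (⇔-elim h))

⇔-from : ⊢ (a ⇔ b) → ⊢ (b ⇒ a)
⇔-from = entail₁ λ h → ⇒-intro (proj₂ (⇔-elim h))

⊢-∧ : ⊢ a → ⊢ b → ⊢ (a ∧ b)
⊢-∧ = entail₂ ∧-intro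

∧-⊢₁ : ⊢ (a ∧ b) → ⊢ a
∧-⊢₁ = entail₁ (proj₁ ∘ ∧-elim)

∧-⊢₂ : ⊢ (a ∧ b) → ⊢ b
∧-⊢₂ = entail₁ (proj₂ ∘ ∧-elim)

⊢-⊤ : ⊢ ⊤'
⊢-⊤ = taut λ _ → refl

contraposition : ⊢ (a ⇒ b) → ⊢ (¬' b ⇒ ¬' a)
contraposition = entail₁ λ f → ⇒-intro λ n → ¬-intro (¬-elim n ∘ ⇒-elim f)

□-mono : ⊢ (a ⇒ b) → ⊢ (□ a ⇒ □ b)
□-mono d = MP K (Nec□ d)

-- `Add` turns `⊤' ⇝ a` into `□ ⊤' ⇝ □ a`, `A4` weakens this to an implication, and `□ ⊤'` is a
-- theorem.
∀⇒□ : ⊢ (A∀ a ⇒ □ a)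
∀⇒□ = entail₂ (λ f □⊤ → ⇒-intro λ h → ⇒-elim (⇒-elim f h) □⊤)
              (Add ⟫ A4) (Nec□ ⊢-⊤)

-- Rigid formulas

-- Rigidity lets t give □ a ⇝ □ b the same value as a ⇝ b, as Add requires, without
-- violating A4.
record Rigid (x : Form) : Set where
  field
    persists : ⊢ (x ⇒ □ x)
    fails    : ⊢ (¬' x ⇒ □ (¬' x))
open Rigid

-- By `A10` a ⇝-formula is equivalent to its own globalisation; `A9` makes the failure of the latter
-- global too, and global truth implies `□`.
⇝-rigid : Rigid (a ⇝ b)
⇝-rigid .persists = ⇔-to A10 ⟫ ∀⇒□
⇝-rigid .fails    =
  contraposition (⇔-from A10) ⟫ A9 ⟫ ∀⇒□ ⟫ □-mono (contraposition (⇔-to A10))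

⊤-rigid : Rigid ⊤'
⊤-rigid .persists = entail₁ (λ h → ⇒-intro λ _ → h) (Nec□ ⊢-⊤)
⊤-rigid .fails    = taut λ _ → refl

¬-rigid : Rigid x → Rigid (¬' x)
¬-rigid r .persists = r .fails
¬-rigid r .fails    = dne ⟫ r .persists ⟫ □-mono dni
  where
  dne : ⊢ (¬' (¬' x) ⇒ x)
  dne = entail₀ (⇒-intro λ h → [ id , ¬-elim h ]′ (⊨-em _ _))
  dni : ⊢ (x ⇒ ¬' (¬' x))
  dni = entail₀ (⇒-intro λ h → ¬-intro λ n → ¬-elim n h)

∧-rigid : Rigid x → Rigid y → Rigid (x ∧ y)
∧-rigid {x} {y} r s .persists = entail₂
  (λ f g → ⇒-intro λ h → ⇒-elim (⇒-elim f (proj₁ (∧-elim h)))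
                                (⇒-elim g (proj₂ (∧-elim h))))
  (r .persists ⟫ □-mono (entail₀ (⇒-intro λ h → ⇒-intro (∧-intro h))) ⟫ K)
  (s .persists)
∧-rigid {x} {y} r s .fails = entail₂
  (λ f g → ⇒-intro λ n →
    [ (λ h → ⇒-elim g (¬-intro (¬-elim n ∘ ∧-intro h))) , ⇒-elim f ]′ (⊨-em _ x))
  (r .fails ⟫ □-mono (contraposition (entail₀ (⇒-intro (proj₁ ∘ ∧-elim)))))
  (s .fails ⟫ □-mono (contraposition (entail₀ (⇒-intro (proj₂ ∘ ∧-elim)))))

-- Occurrence of a variable and shapes of ⇝-formulas

occurs? : ∀ p a → Dec (p occursIn a)
occurs? p (var n) = map′ (λ { refl → here }) (λ { here → refl }) (p ≟ n)
occurs? p ⊤'      = no λ ()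
occurs? p ⊥'      = no λ ()
occurs? p (¬' a)  = map′ ¬o (λ { (¬o o) → o }) (occurs? p a)
occurs? p (a ∧ b) = map′ [ ∧l , ∧r ]′ (λ { (∧l o) → inj₁ o ; (∧r o) → inj₂ o })
                         (occurs? p a ⊎-dec occurs? p b)
occurs? p (a ∨ b) = map′ [ ∨l , ∨r ]′ (λ { (∨l o) → inj₁ o ; (∨r o) → inj₂ o })
                         (occurs? p a ⊎-dec occurs? p b)
occurs? p (a ⇒ b) = map′ [ ⇒l , ⇒r ]′ (λ { (⇒l o) → inj₁ o ; (⇒r o) → inj₂ o })
                         (occurs? p a ⊎-dec occurs? p b)
occurs? p (a ⇔ b) = map′ [ ⇔l , ⇔r ]′ (λ { (⇔l o) → inj₁ o ; (⇔r o) → inj₂ o })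
                         (occurs? p a ⊎-dec occurs? p b)
occurs? p (a ⇝ b) = map′ [ ⇝l , ⇝r ]′ (λ { (⇝l o) → inj₁ o ; (⇝r o) → inj₂ o })
                         (occurs? p a ⊎-dec occurs? p b)
occurs? p (□ a)   = map′ □o (λ { (□o o) → o }) (occurs? p a)

-- The shapes of a ⇝ b, other than the last, on which an axiom prescribes the translation.
data View : Form → Form → Set where
  ∨-left         : ∀ a b c → View (a ∨ b) c
  ⊥-left         : ∀ c → View ⊥' c
  ∧-right        : ∀ a b c → View a (b ∧ c)
  ⊤-right        : ∀ a → View a ⊤'
  contrapositive : ∀ a b → View (¬' a) (¬' b)
  ∀-⇝            : ∀ a b → View ⊤' (a ⇝ b)
  ∀-¬∀           : ∀ a → View ⊤' (¬' (⊤' ⇝ a))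
  ¬∀-⊥           : ∀ a → View (¬' (⊤' ⇝ a)) ⊥'
  boxes          : ∀ a b → View (□ a) (□ b)
  other          : ∀ a b → View a b

-- The order of clauses matters where shapes overlap: `∨` or `⊥'` on the left takes precedence over
-- `∧` or `⊤'` on the right.
view : ∀ a b → View a b
view (a ∨ b)       c             = ∨-left a b c
view ⊥'            c             = ⊥-left c
view a             (b ∧ c)       = ∧-right a b c
view a             ⊤'            = ⊤-right a
view (¬' a)        (¬' b)        = contrapositive a b
view ⊤'            (a ⇝ b)       = ∀-⇝ a b
view ⊤'            (¬' (⊤' ⇝ a)) = ∀-¬∀ a
view (¬' (⊤' ⇝ a)) ⊥'            = ¬∀-⊥ a
view (□ a)         (□ b)         = boxes a b
view a             b             = other a b

-- The translation

module Translation (p : ℕ) (φ : Form) where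

  mutual
    t : Form → Form
    t (var n) with p ≟ n
    ... | yes _ = φ
    ... | no  _ = var n
    t ⊤'      = ⊤'
    t ⊥'      = ⊥'
    t (¬' a)  = ¬' (t a)
    t (a ∧ b) = t a ∧ t b
    t (a ∨ b) = t a ∨ t b
    t (a ⇒ b) = t a ⇒ t b
    t (a ⇔ b) = t a ⇔ t b
    t (a ⇝ b) = T a b
    t (□ a)   = □ (t a)

    -- A function of two formulas keeps the recursion structural: `T (a ∨ b) c` calls `T a c`,
    -- although `a ⇝ c` is no subformula of `(a ∨ b) ⇝ c`.
    T : Form → Form → Form
    T a b with occurs? p (a ⇝ b)
    ... | no  _ = a ⇝ b
    ... | yes _ = split (view a b)

    split : View a b → Form
    split (∨-left a b c)       = T a c ∧ T b c
    split (⊥-left c)           = ⊤'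
    split (∧-right a b c)      = T a b ∧ T a c
    split (⊤-right a)          = ⊤'
    split (contrapositive a b) = T b a
    split (∀-⇝ a b)            = T a b
    -- `A9` bounds this value from below and `A4` from above. In the next clause `A11` and `A4` do
    -- the same.
    split (∀-¬∀ a)             = ¬' (T ⊤' a)
    split (¬∀-⊥ a)             = T ⊤' a
    -- `Add` only asks that `T a b` imply this value; the strongest choice is taken.
    split (boxes a b)          = T a b
    split (other a b)          = A∀ (t a ⇒ t b)

  T-free : ∀ a b → ¬ (p occursIn (a ⇝ b)) → T a b ≡ a ⇝ b
  T-free a b f with occurs? p (a ⇝ b)
  ... | no  _ = refl
  ... | yes o = contradiction o f

  t-free : ∀ a → ¬ (p occursIn a) → t a ≡ a
  t-free (var n) f with p ≟ n
  ... | yes refl = contradiction here f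
  ... | no  _    = refl
  t-free ⊤'      f = refl
  t-free ⊥'      f = refl
  t-free (¬' a)  f = cong ¬' (t-free a (f ∘ ¬o))
  t-free (a ∧ b) f = cong₂ _∧_ (t-free a (f ∘ ∧l)) (t-free b (f ∘ ∧r))
  t-free (a ∨ b) f = cong₂ _∨_ (t-free a (f ∘ ∨l)) (t-free b (f ∘ ∨r))
  t-free (a ⇒ b) f = cong₂ _⇒_ (t-free a (f ∘ ⇒l)) (t-free b (f ∘ ⇒r))
  t-free (a ⇔ b) f = cong₂ _⇔_ (t-free a (f ∘ ⇔l)) (t-free b (f ∘ ⇔r))
  t-free (a ⇝ b) f = T-free a b f
  t-free (□ a)   f = cong □ (t-free a (f ∘ □o))

  -- Rigidity of the values of `T`, and axiom `A4`

  mutual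
    -- Every value is built from ⇝-formulas and `⊤'` by `∧` and `¬'`, which preserve rigidity.
    T-rigid : ∀ a b → Rigid (T a b)
    T-rigid a b with occurs? p (a ⇝ b)
    ... | no  _ = ⇝-rigid
    ... | yes _ = split-rigid (view a b)

    split-rigid : (w : View a b) → Rigid (split w)
    split-rigid (∨-left a b c)         = ∧-rigid (T-rigid a c) (T-rigid b c)
    split-rigid (⊥-left c)             = ⊤-rigid
    split-rigid (∧-right a b c)        = ∧-rigid (T-rigid a b) (T-rigid a c)
    split-rigid (⊤-right a)            = ⊤-rigid
    split-rigid (contrapositive a b)   = T-rigid b a
    split-rigid (∀-⇝ a b)              = T-rigid a b
    split-rigid (∀-¬∀ a)               = ¬-rigid (T-rigid ⊤' a)
    split-rigid (¬∀-⊥ a)               = T-rigid ⊤' a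
    split-rigid (boxes a b)            = T-rigid a b
    split-rigid (other a b)            = ⇝-rigid

  mutual
    T-A4 : ∀ a b → ⊢ (T a b ⇒ t a ⇒ t b)
    T-A4 a b with occurs? p (a ⇝ b)
    ... | no f rewrite t-free a (f ∘ ⇝l) | t-free b (f ∘ ⇝r) = A4
    ... | yes _ = split-A4 (view a b)

    split-A4 : (w : View a b) → ⊢ (split w ⇒ t a ⇒ t b)
    split-A4 (∨-left a b c) = entail₂
      (λ f g → ⇒-intro λ h → ⇒-intro λ k →
        [ ⇒-elim (⇒-elim f (proj₁ (∧-elim h)))
        , ⇒-elim (⇒-elim g (proj₂ (∧-elim h))) ]′ (∨-elim k))
      (T-A4 a c) (T-A4 b c)
    split-A4 (⊥-left c) = taut λ _ → refl
    split-A4 (∧-right a b c) = entail₂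
      (λ f g → ⇒-intro λ h → ⇒-intro λ k →
        ∧-intro (⇒-elim (⇒-elim f (proj₁ (∧-elim h))) k)
                (⇒-elim (⇒-elim g (proj₂ (∧-elim h))) k))
      (T-A4 a b) (T-A4 a c)
    split-A4 (⊤-right a) = entail₁ (λ h → ⇒-intro λ _ → ⇒-intro λ _ → h) ⊢-⊤
    split-A4 (contrapositive a b) = entail₁
      (λ f → ⇒-intro λ h → ⇒-intro λ n →
        ¬-intro λ k → ¬-elim n (⇒-elim (⇒-elim f h) k))
      (T-A4 b a)
    split-A4 (∀-⇝ a b) = entail₀ (⇒-intro λ h → ⇒-intro λ _ → h)
    split-A4 (∀-¬∀ a) = entail₀ (⇒-intro λ h → ⇒-intro λ _ → h)
    split-A4 (¬∀-⊥ a) =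
      entail₀ (⇒-intro λ h → ⇒-intro λ n → ¬-elim n h)
    -- The value `T a b` carries no box, so rigidity first supplies `□ (T a b)`; the induction
    -- hypothesis is then applied under the box.
    split-A4 (boxes a b) = T-rigid a b .persists ⟫ □-mono (T-A4 a b) ⟫ K
    split-A4 (other a b) =
      A4 ⟫ entail₁ (λ h → ⇒-intro λ f → ⇒-elim f h) ⊢-⊤

  -- The remaining ⇝-axioms

  T-⊥ : ∀ b → ⊢ T ⊥' b
  T-⊥ b with occurs? p (⊥' ⇝ b)
  ... | no  _ = ∧-⊢₁ (A1 {b})
  ... | yes _ = ⊢-⊤

  mutual
    T-⊤ : ∀ a → ⊢ T a ⊤'
    T-⊤ a with occurs? p (a ⇝ ⊤')
    ... | no  _ = ∧-⊢₂ A1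
    ... | yes _ = split-⊤ (view a ⊤')

    split-⊤ : (w : View a ⊤') → ⊢ split w
    split-⊤ (∨-left a b _) = ⊢-∧ (T-⊤ a) (T-⊤ b)
    split-⊤ (⊥-left _)     = ⊢-⊤
    split-⊤ (⊤-right _)    = ⊢-⊤
    -- `view` never returns this shape for `⊤'` on the right, but `View` admits it, and its value is
    -- provable as well.
    split-⊤ (other _ _)    = Nec∀ (entail₁ (λ h → ⇒-intro λ _ → h) ⊢-⊤)

  -- If `p` occurs, `view` selects this very shape and both sides coincide; otherwise `t` changes
  -- nothing and the axiom itself applies. `T-A5` to `T-Add` follow the same pattern.
  T-A2 : ∀ a b c → ⊢ (T (a ∨ b) c ⇔ T a c ∧ T b c)
  T-A2 a b c with occurs? p ((a ∨ b) ⇝ c)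
  ... | yes _ = ⇔-refl
  ... | no  f
    rewrite T-free a c (λ { (⇝l o) → f (⇝l (∨l o)) ; (⇝r o) → f (⇝r o) })
          | T-free b c (λ { (⇝l o) → f (⇝l (∨r o)) ; (⇝r o) → f (⇝r o) }) = A2

  T-A3 : ∀ a b c → ⊢ (T a (b ∧ c) ⇔ T a b ∧ T a c)
  T-A3 a b c with occurs? p (a ⇝ (b ∧ c))
  T-A3 a b c | no f
    rewrite T-free a b (λ { (⇝l o) → f (⇝l o) ; (⇝r o) → f (⇝r (∧l o)) })
          | T-free a c (λ { (⇝l o) → f (⇝l o) ; (⇝r o) → f (⇝r (∧r o)) }) = A3
  -- Here `view` splits the disjunction first, so the two decompositions are interchanged by
  -- induction on the left formula.
  T-A3 (a₁ ∨ a₂) b c | yes _ = entail₂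
    (λ or and →
      let or₁ , or₂ = ∧-elim or ; and₁ , and₂ = ∧-elim and in ⇔-intro
      (λ h → let h₁ , h₂ = ∧-elim h
                 b₁ , c₁ = ∧-elim (proj₁ (⇔-elim and₁) h₁)
                 b₂ , c₂ = ∧-elim (proj₁ (⇔-elim and₂) h₂)
             in ∧-intro (proj₂ (⇔-elim or₁) (∧-intro b₁ b₂))
                        (proj₂ (⇔-elim or₂) (∧-intro c₁ c₂)))
      (λ h → let hb , hc = ∧-elim h
                 b₁ , b₂ = ∧-elim (proj₁ (⇔-elim or₁) hb)
                 c₁ , c₂ = ∧-elim (proj₁ (⇔-elim or₂) hc)
             in ∧-intro (proj₂ (⇔-elim and₁) (∧-intro b₁ c₁))
                        (proj₂ (⇔-elim and₂) (∧-intro b₂ c₂))))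
    (⊢-∧ (T-A2 a₁ a₂ b) (T-A2 a₁ a₂ c))
    (⊢-∧ (T-A3 a₁ b c) (T-A3 a₂ b c))
  T-A3 ⊥' b c        | yes _ = entail₂
    (λ h k → ⇔-intro (λ _ → ∧-intro h k) (λ _ → holds refl)) (T-⊥ b) (T-⊥ c)
  -- The remaining left formulas are listed so that `view` reduces to `∧-right`.
  T-A3 (var _) b c   | yes _ = ⇔-refl
  T-A3 ⊤' b c        | yes _ = ⇔-refl
  T-A3 (¬' _) b c    | yes _ = ⇔-refl
  T-A3 (_ ∧ _) b c   | yes _ = ⇔-refl
  T-A3 (_ ⇒ _) b c   | yes _ = ⇔-refl
  T-A3 (_ ⇔ _) b c   | yes _ = ⇔-refl
  T-A3 (_ ⇝ _) b c   | yes _ = ⇔-refl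
  T-A3 (□ _) b c     | yes _ = ⇔-refl

  T-A5 : ∀ a b → ⊢ (T a b ⇔ T (¬' b) (¬' a))
  T-A5 a b with occurs? p (¬' b ⇝ ¬' a)
  ... | yes _ = ⇔-refl
  ... | no  f
    rewrite T-free a b (λ { (⇝l o) → f (⇝r (¬o o)) ; (⇝r o) → f (⇝l (¬o o)) }) = A5

  T-A8 : ∀ a → ⊢ (T ⊤' a ⇒ T ⊤' (⊤' ⇝ a))
  T-A8 a with occurs? p (⊤' ⇝ (⊤' ⇝ a))
  ... | yes _ = ⇒-refl
  ... | no  f rewrite T-free ⊤' a (f ∘ ⇝r) = A8

  T-A9 : ∀ a → ⊢ (¬' (T ⊤' a) ⇒ T ⊤' (¬' (⊤' ⇝ a)))
  T-A9 a with occurs? p (⊤' ⇝ ¬' (⊤' ⇝ a))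
  ... | yes _ = ⇒-refl
  ... | no  f rewrite T-free ⊤' a (f ∘ ⇝r ∘ ¬o) = A9

  T-A10 : ∀ a b → ⊢ (T a b ⇔ T ⊤' (a ⇝ b))
  T-A10 a b with occurs? p (⊤' ⇝ (a ⇝ b))
  ... | yes _ = ⇔-refl
  ... | no  f rewrite T-free a b (f ∘ ⇝r) = A10

  T-A11 : ∀ a → ⊢ (T ⊤' a ⇒ T (¬' (⊤' ⇝ a)) ⊥')
  T-A11 a with occurs? p (¬' (⊤' ⇝ a) ⇝ ⊥')
  ... | yes _ = ⇒-refl
  ... | no  f rewrite T-free ⊤' a (f ∘ ⇝l ∘ ¬o) = A11

  T-Add : ∀ a b → ⊢ (T a b ⇒ T (□ a) (□ b))
  T-Add a b with occurs? p (□ a ⇝ □ b)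
  ... | yes _ = ⇒-refl
  ... | no  f
    rewrite T-free a b (λ { (⇝l o) → f (⇝l (□o o)) ; (⇝r o) → f (⇝r (□o o)) }) = Add

  -- Global necessitation and the premise `p ⇝ φ`

  mutual
    -- Conjunctions split the premise, and for `∀-⇝` and `∀-¬∀` the value is `t a` itself.
    T-Nec∀ : ∀ a → ⊢ t a → ⊢ T ⊤' a
    T-Nec∀ a d with occurs? p (⊤' ⇝ a)
    ... | no  f rewrite t-free a (f ∘ ⇝r) = Nec∀ d
    ... | yes _ = split-Nec∀ (view ⊤' a) d

    split-Nec∀ : (w : View ⊤' a) → ⊢ t a → ⊢ split w
    split-Nec∀ (∧-right _ a b) d = ⊢-∧ (T-Nec∀ a (∧-⊢₁ d)) (T-Nec∀ b (∧-⊢₂ d))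
    split-Nec∀ (⊤-right _)     d = ⊢-⊤
    split-Nec∀ (∀-⇝ _ _)       d = d
    split-Nec∀ (∀-¬∀ _)        d = d
    split-Nec∀ (other _ _)     d = Nec∀ (entail₁ (λ h → ⇒-intro λ _ → h) d)

  t-var : t (var p) ≡ φ
  t-var with p ≟ p
  ... | yes _ = refl
  ... | no  f = contradiction refl f

  mutual
    -- A general `b` in place of `φ` lets the induction descend to conjuncts: with a variable on the
    -- left, only `∧` and `⊤'` on the right are special.
    T-var : ∀ b → ⊢ (φ ⇒ t b) → ⊢ T (var p) b
    T-var b d with occurs? p (var p ⇝ b)
    ... | no  f = contradiction (⇝l here) f
    ... | yes _ = split-var (view (var p) b) d

    split-var : (w : View (var p) b) → ⊢ (φ ⇒ t b) → ⊢ split w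
    split-var (∧-right _ b c) d = ⊢-∧
      (T-var b (d ⟫ entail₀ (⇒-intro (proj₁ ∘ ∧-elim))))
      (T-var c (d ⟫ entail₀ (⇒-intro (proj₂ ∘ ∧-elim))))
    split-var (⊤-right _)     d = ⊢-⊤
    split-var (other _ _)     d rewrite t-var = Nec∀ d

  -- Soundness of the translation

  -- Pulling `v` back along `t` gives a valuation, even where `t` sends an atom to a compound
  -- formula; hence tautologies are preserved.
  evalPL-t : ∀ v a → evalPL v (t a) ≡ evalPL (λ x → evalPL v (t x)) a
  evalPL-t v (var n) = refl
  evalPL-t v ⊤'      = refl
  evalPL-t v ⊥'      = refl
  evalPL-t v (¬' a)  rewrite evalPL-t v a = refl
  evalPL-t v (a ∧ b) rewrite evalPL-t v a with evalPL (λ x → evalPL v (t x)) a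
  ... | true  = evalPL-t v b
  ... | false = refl
  evalPL-t v (a ∨ b) rewrite evalPL-t v a with evalPL (λ x → evalPL v (t x)) a
  ... | true  = refl
  ... | false = evalPL-t v b
  evalPL-t v (a ⇒ b) rewrite evalPL-t v a with evalPL (λ x → evalPL v (t x)) a
  ... | true  = evalPL-t v b
  ... | false = refl
  evalPL-t v (a ⇔ b) rewrite evalPL-t v a | evalPL-t v b = refl
  evalPL-t v (a ⇝ b) = refl
  evalPL-t v (□ a)   = refl

  t-sound : ⊢ a → ⊢ t a
  t-sound (taut {a} h)       = taut λ v → trans (evalPL-t v a) (h _)
  t-sound (A1 {a})           = ⊢-∧ (T-⊥ a) (T-⊤ a)
  t-sound (A2 {a} {b} {c})   = T-A2 a b c
  t-sound (A3 {a} {b} {c})   = T-A3 a b c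
  t-sound (A4 {a} {b})       = T-A4 a b
  t-sound (A5 {a} {b})       = T-A5 a b
  t-sound (A8 {a})           = T-A8 a
  t-sound (A9 {a})           = T-A9 a
  t-sound (A10 {a} {b})      = T-A10 a b
  t-sound (A11 {a})          = T-A11 a
  t-sound K                  = K
  t-sound (Add {a} {b})      = T-Add a b
  t-sound (MP d e)           = MP (t-sound d) (t-sound e)
  t-sound (Nec∀ {a} d)       = T-Nec∀ a (t-sound d)
  t-sound (Nec□ d)           = Nec□ (t-sound d)

-- Admissibility of (UC)

theorem4p13 : (p : ℕ) (φ ψ : Form) → ¬ (p occursIn φ) → ¬ (p occursIn ψ)
    → ⊢ (((var p ⇝ φ) ∧ □ (var p)) ⇒ ψ) → ⊢ (□ φ ⇒ ψ)
theorem4p13 p φ ψ p∉φ p∉ψ d = entail₂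
  (λ f g → ⇒-intro λ h → ⇒-elim f (∧-intro g h))
  translated
  -- Since `p` is absent from `φ`, `t φ` is `φ`, and the first conjunct of the translated premise is
  -- a theorem.
  (T-var φ (subst (λ x → ⊢ (φ ⇒ x)) (sym (t-free φ p∉φ)) ⇒-refl))
  where
  open Translation p φ
  translated : ⊢ (T (var p) φ ∧ □ φ ⇒ ψ)
  translated = subst₂ (λ x y → ⊢ (T (var p) φ ∧ □ x ⇒ y)) t-var (t-free ψ p∉ψ) (t-sound d)
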